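{- (1) For all integers $n \geq 1$, either $X(Y(n)) = X(n)+Y(n)$ or $Y(X(n)) = X(n)+Y(n)$. (2) For all integers $n \geq 1$, we have $X(n)+Y(n)-Y(X(n)) \in \{0,1,2\}$.
   Context: The sequences $(X(n))_{n\ge 0}$ and $(Y(n))_{n\ge 0}$ of non-negative integers (OEIS A140100 and A140101) are defined recursively as follows. Start with $X(0)=0$, $Y(0)=0$, $X(1)=1$, $Y(1)=2$. For $n>1$, choose the least positive integers $Y(n)>X(n)$ such that neither $Y(n)$ nor $X(n)$ appears in $\{Y(k) : 1\le k<n\}$ or $\{X(k): 1\le k<n\}$, and such that $Y(n)-X(n)$ does not appear in $\{Y(k)-X(k): 1\le k<n\}$ or $\{Y(k)+X(k): 1\le k<n\}$. Here "least" means: call $(n,x,y)$ good if $y>x$ are positive integers satisfying all of these conditions with $(x,y)$ in place of $(X(n),Y(n))$; then $X(n)$ is the least $x$ such that $(n,x,y)$ is good for some $y$, and $Y(n)$ is the least $y$ such that $(n,X(n),y)$ is good. First values for $n=0,1,2,\ldots$: $X = 0,1,3,4,6,7,9,10,12,14,15,\ldots$ and $Y = 0,2,5,8,11,13,16,19,22,25,28,\ldots$. -}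

module Defs where

open import Data.List using (List; []; _∷_)
open import Data.List.Relation.Unary.All as All using (All; []; _∷_)
open import Data.Nat
open import Data.Nat.Properties
open import Data.Product using (_×_; _,_; proj₁; proj₂; ∃; ∃₂)
open import Data.Sum using (inj₁; inj₂)
open import Data.Empty using (⊥-elim)
open import Relation.Binary.PropositionalEquality using (_≡_; _≢_; refl; sym)
open import Relation.Nullary using (Dec; yes; no)
open import Relation.Nullary.Decidable using (_×-dec_; ¬?; map′)
open import Relation.Unary using (Pred; Decidable)

IsLeast : ∀ {ℓ} → Pred ℕ ℓ → Pred ℕ ℓ
IsLeast P m = P m × (∀ k → P k → m ≤ k)

-- A new pair (x , y) does not clash with an earlier pair (a , b).  The
-- subtractions are never truncated where this is used: x < y is required by
-- Good, and a < b holds for every earlier pair.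
Avoids : ℕ → ℕ → ℕ → ℕ → Set
Avoids a b x y =
  (x ≢ a) × (x ≢ b) × (y ≢ a) × (y ≢ b) × (y ∸ x ≢ b ∸ a) × (y ∸ x ≢ b + a)

record Good (X Y : ℕ → ℕ) (n x y : ℕ) : Set where
  constructor good
  field
    positive : 1 ≤ x
    ordered  : x < y
    fresh    : ∀ k → 1 ≤ k → k < n → Avoids (X k) (Y k) x y

-- X and Y are the sequences A140100 and A140101.
record IsGreedyPair (X Y : ℕ → ℕ) : Set where
  field
    X0 : X 0 ≡ 0
    Y0 : Y 0 ≡ 0
    X1 : X 1 ≡ 1
    Y1 : Y 1 ≡ 2
    X-least : ∀ n → 1 < n → IsLeast (λ x → ∃ λ y → Good X Y n x y) (X n)
    Y-least : ∀ n → 1 < n → IsLeast (λ y → Good X Y n (X n) y) (Y n)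

-- The rest of this module shows that the recursive definition is meaningful,
-- i.e. that some X and Y satisfy IsGreedyPair.

private

  least : ∀ {ℓ} {P : Pred ℕ ℓ} → Decidable P → ∀ {m} → P m → ∃ (IsLeast P)
  least P? {zero} Pm = 0 , Pm , λ _ _ → z≤n
  least {P = P} P? {suc m} Pm with P? 0
  ... | yes P0 = 0 , P0 , λ _ _ → z≤n
  ... | no ¬P0 with least (λ k → P? (suc k)) {m} Pm
  ...   | l , Pl , l≤ = suc l , Pl , bound
    where
    bound : ∀ k → P k → suc l ≤ k
    bound zero    P0 = ⊥-elim (¬P0 P0)
    bound (suc k) Pk = s≤s (l≤ k Pk)

  History : Set
  History = List (ℕ × ℕ)

  GoodFor : History → ℕ → ℕ → Set
  GoodFor h x y = 1 ≤ x × x < y × All (λ (a , b) → Avoids a b x y) h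

  goodFor? : ∀ h x y → Dec (GoodFor h x y)
  goodFor? h x y = (1 ≤? x) ×-dec (x <? y) ×-dec All.all? (λ (a , b) →
    ¬? (x ≟ a) ×-dec ¬? (x ≟ b) ×-dec ¬? (y ≟ a) ×-dec ¬? (y ≟ b) ×-dec
    ¬? (y ∸ x ≟ b ∸ a) ×-dec ¬? (y ∸ x ≟ b + a)) h

  Unused : History → ℕ → Set
  Unused h x = 1 ≤ x × All (λ (a , b) → (x ≢ a) × (x ≢ b)) h

  unused? : ∀ h x → Dec (Unused h x)
  unused? h x = (1 ≤? x) ×-dec All.all? (λ (a , b) → ¬? (x ≟ a) ×-dec ¬? (x ≟ b)) h

  total : History → ℕ
  total []            = 0
  total ((a , b) ∷ h) = (b + a) + total h

  ≤total : (h : History) → All {A = ℕ × ℕ} (λ (a , b) → b + a ≤ total h) h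
  ≤total []            = []
  ≤total ((a , b) ∷ h) =
    m≤m+n (b + a) (total h) ∷
    All.map (λ p → ≤-trans p (m≤n+m (total h) (b + a))) (≤total h)

  big : ∀ {a c t} → a ≤ c → c ≤ t → ∀ {z} → t < z → z ≢ a
  big a≤c c≤t t<z = >⇒≢ (≤-<-trans (≤-trans a≤c c≤t) t<z)

  fresh-x : ∀ h → Unused h (suc (total h))
  fresh-x h = s≤s z≤n , All.map
    (λ {(a , b)} p → big (m≤n+m a b) p ≤-refl , big (m≤m+n b a) p ≤-refl)
    (≤total h)

  partner : ∀ h {x} → Unused h x → GoodFor h x (x + suc (total h))
  partner h {x} (1≤x , u) = 1≤x , m<m+n x (s≤s z≤n) , All.map
    (λ {(a , b)} ((x≢a , x≢b) , p) →
      x≢a , x≢b ,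
      big (m≤n+m a b) p t<y , big (m≤m+n b a) p t<y ,
      big (≤-trans (m∸n≤m b a) (m≤m+n b a)) p t<d , big ≤-refl p t<d)
    (All.zip (u , ≤total h))
    where
    t<y : total h < x + suc (total h)
    t<y = m≤n+m (suc (total h)) x
    t<d : total h < x + suc (total h) ∸ x
    t<d = ≤-reflexive (sym (m+n∸m≡n x (suc (total h))))

  goodFor⇒unused : ∀ h {x y} → GoodFor h x y → Unused h x
  goodFor⇒unused h (1≤x , _ , f) = 1≤x , All.map (λ (p , q , _) → p , q) f

  abstract

    next-x : ∀ h → ∃ (IsLeast (λ x → ∃ (GoodFor h x)))
    next-x h = least
      (λ x → map′ (λ u → _ , partner h u) (λ (_ , g) → goodFor⇒unused h g) (unused? h x))
      (_ , partner h (fresh-x h))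

    next-y : ∀ h → ∃ (IsLeast (GoodFor h (proj₁ (next-x h))))
    next-y h = least (goodFor? h _) (proj₂ (proj₁ (proj₂ (next-x h))))

  -- pairAt n is the n-th pair and history n lists the pairs of index 1, …, n - 1.
  pairAt  : ℕ → ℕ × ℕ
  history : ℕ → History

  pairAt 0 = 0 , 0
  pairAt 1 = 1 , 2
  pairAt (suc (suc n)) =
    let h = pairAt (suc n) ∷ history (suc n) in proj₁ (next-x h) , proj₁ (next-y h)

  history 0 = []
  history 1 = []
  history (suc (suc n)) = pairAt (suc n) ∷ history (suc n)

  Xs Ys : ℕ → ℕ
  Xs n = proj₁ (pairAt n)
  Ys n = proj₂ (pairAt n)

  module _ {Q : ℕ × ℕ → Set} where

    all⇒ : ∀ n → All Q (history n) → ∀ k → 1 ≤ k → k < n → Q (pairAt k)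
    all⇒ 1 _ (suc k) _ (s≤s ())
    all⇒ (suc (suc n)) (q ∷ qs) k 1≤k (s≤s k≤) with m≤n⇒m<n∨m≡n k≤
    ... | inj₁ k<   = all⇒ (suc n) qs k 1≤k k<
    ... | inj₂ refl = q

    ⇒all : ∀ n → (∀ k → 1 ≤ k → k < n → Q (pairAt k)) → All Q (history n)
    ⇒all 0 f = []
    ⇒all 1 f = []
    ⇒all (suc (suc n)) f =
      f (suc n) (s≤s z≤n) ≤-refl ∷ ⇒all (suc n) (λ k 1≤k k< → f k 1≤k (m<n⇒m<1+n k<))

  toGood : ∀ n {x y} → GoodFor (history n) x y → Good Xs Ys n x y
  toGood n (p , q , f) = good p q (all⇒ n f)

  fromGood : ∀ n {x y} → Good Xs Ys n x y → GoodFor (history n) x y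
  fromGood n (good p q f) = p , q , ⇒all n f

greedyPair-exists : ∃₂ IsGreedyPair
greedyPair-exists = Xs , Ys , record
  { X0 = refl
  ; Y0 = refl
  ; X1 = refl
  ; Y1 = refl
  ; X-least = X-least
  ; Y-least = Y-least
  }
  where
  X-least : ∀ n → 1 < n → IsLeast (λ x → ∃ λ y → Good Xs Ys n x y) (Xs n)
  X-least 1 (s≤s ())
  X-least n@(suc (suc _)) _ =
    let _ , (y , g) , l = next-x (history n)
    in (y , toGood n g) , λ k (z , g′) → l k (z , fromGood n g′)

  Y-least : ∀ n → 1 < n → IsLeast (λ y → Good Xs Ys n (Xs n) y) (Ys n)
  Y-least 1 (s≤s ())
  Y-least n@(suc (suc _)) _ =
    let _ , g , l = next-y (history n)
    in toGood n g , λ k g′ → l k (fromGood n g′)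

{-# OPTIONS --safe #-}

-- Let t be the tribonacci word, the fixed point of τ : a ↦ ab, b ↦ ac, c ↦ a,
-- and let P n be its prefix of length n.  Then X (n + 1) = 1 + |P n| and
-- Y (n + 1) = 2 + |P n| when the letters a, b, c weigh 2, 1, 1 and 3, 3, 2
-- respectively, and the differences and sums have weights 1, 2, 1 and 5, 4, 3.
-- Applying τ to P n turns X-weights into Y-weights, so the sequence X passes over
-- exactly one value, a value of Y, at each letter a; applying τ twice shows in
-- the same way that Y - X passes over a value of Y + X at each letter b.  Hence
-- both pairs of sequences are complementary, which forces the greedy choice.
--
-- Both claims follow from Y (X n) ≤ X n + Y n < Y (X n + 1).  It compares the
-- prefix P n with the prefix of length |P n| in X-weights; the two can be
-- decomposed in parallel into nine pairs of blocks with matching weights, a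
-- set closed under τ, and inside each pair the inequality is a finite check.
module Submission where

open import Defs
open import Data.Integer.Properties using (m-n≡m⊖n; ⊖-≥)
open import Data.List
  using (List; []; _∷_; [_]; _++_; length; map; take; drop; concatMap; applyUpTo)
open import Data.List.Membership.Propositional using (_∈_)
open import Data.List.Properties
  using ( ++-assoc; ++-identityʳ; length-++; length-++-≤ˡ; concatMap-++; concatMap-cong; map-++
        ; take++drop≡id; take-all; applyUpTo-∷ʳ; length-applyUpTo)
open import Data.List.Relation.Unary.Any using (here; there)
open import Data.Nat
open import Data.Nat.Induction using (<-rec)
open import Data.Nat.ListAction using (sum)
open import Data.Nat.ListAction.Properties using (sum-++)
open import Data.Nat.Properties
open import Data.Nat.Solver using (module +-*-Solver)
open import Data.Product using (_×_; _,_; proj₁; proj₂; ∃; ∃₂)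
open import Data.Sum using (_⊎_; inj₁; inj₂)
open import Function using (_∘_)
open import Relation.Binary.PropositionalEquality hiding ([_])
open import Relation.Nullary using (Dec; yes; no; ¬_; contradiction)
open import Relation.Nullary.Decidable using (from-yes; _×-dec_)

-- Lists: iterated `concatMap`, and `take` across a concatenation.

concatMap-concatMap : ∀ {A B C : Set} (f : B → List C) (g : A → List B) xs →
  concatMap f (concatMap g xs) ≡ concatMap (concatMap f ∘ g) xs
concatMap-concatMap f g []       = refl
concatMap-concatMap f g (x ∷ xs) =
  trans (concatMap-++ f (g x) _) (cong (concatMap f (g x) ++_) (concatMap-concatMap f g xs))

module _ {A : Set} where

  take-++ˡ : ∀ {n} (u : List A) {v} → n ≤ length u → take n (u ++ v) ≡ take n u
  take-++ˡ {zero}  u       _       = refl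
  take-++ˡ {suc n} (x ∷ u) (s≤s p) = cong (x ∷_) (take-++ˡ u p)

  take-++ʳ : ∀ n (u : List A) {v} → take (length u + n) (u ++ v) ≡ u ++ take n v
  take-++ʳ n []      = refl
  take-++ʳ n (x ∷ u) = cong (x ∷_) (take-++ʳ n u)

-- The tribonacci word

data Letter : Set where
  a b c : Letter

τ : Letter → List Letter
τ a = a ∷ b ∷ []
τ b = a ∷ c ∷ []
τ c = a ∷ []

τ* : List Letter → List Letter
τ* = concatMap τ

word : ℕ → List Letter
word zero    = [ a ]
word (suc k) = τ* (word k)

τ*-++ : ∀ u v → τ* (u ++ v) ≡ τ* u ++ τ* v
τ*-++ = concatMap-++ τ

τ*-∷ : ∀ l u → ∃₂ λ m v → τ* (l ∷ u) ≡ m ∷ v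
τ*-∷ a u = a , b ∷ τ* u , refl
τ*-∷ b u = a , c ∷ τ* u , refl
τ*-∷ c u = a , τ* u , refl

-- `τ` erases no letter, so a non-empty extension stays non-empty under `τ*`; this makes the lengths
-- strictly increase.
word-extends : ∀ k → ∃₂ λ l v → word (suc k) ≡ word k ++ l ∷ v
word-extends zero    = b , [] , refl
word-extends (suc k) =
  let l , u , eq  = word-extends k
      m , v , eq′ = τ*-∷ l u
  in m , v , trans (cong τ* eq) (trans (τ*-++ (word k) (l ∷ u)) (cong (word (suc k) ++_) eq′))

word-prefix : ∀ j k → ∃ λ v → word (j + k) ≡ word k ++ v
word-prefix zero    k = [] , sym (++-identityʳ _)
word-prefix (suc j) k =
  let v , eq      = word-prefix j k
      l , w , eq′ = word-extends (j + k)
  in v ++ l ∷ w , trans eq′ (trans (cong (_++ l ∷ w) eq) (++-assoc (word k) v _))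

<length-word : ∀ k → k < length (word k)
<length-word zero    = s≤s z≤n
<length-word (suc k) =
  let l , v , eq = word-extends k in begin-strict
    suc k                          ≤⟨ <length-word k ⟩
    length (word k)                <⟨ m<m+n _ (s≤s z≤n) ⟩
    length (word k) + suc (length v) ≡⟨ length-++ (word k) ⟨
    length (word k ++ l ∷ v)       ≡⟨ cong length eq ⟨
    length (word (suc k))          ∎
  where open ≤-Reasoning

-- Past the end of the list, nth returns the junk value a.
nth : ℕ → List Letter → Letter
nth _       []      = a
nth zero    (l ∷ u) = l
nth (suc i) (l ∷ u) = nth i u

nth-++ : ∀ {i} u {v} → i < length u → nth i (u ++ v) ≡ nth i u
nth-++ {zero}  (l ∷ u) _       = refl
nth-++ {suc i} (l ∷ u) (s≤s p) = nth-++ u p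

nth-length : ∀ u {l v} → nth (length u) (u ++ l ∷ v) ≡ l
nth-length []      = refl
nth-length (x ∷ u) = nth-length u

-- By `<length-word`, position `n` lies inside `word n`, so the junk value of `nth` never enters.
t : ℕ → Letter
t n = nth n (word n)

P : ℕ → List Letter
P = applyUpTo t

P-suc : ∀ n → P (suc n) ≡ P n ++ [ t n ]
P-suc n = sym (applyUpTo-∷ʳ t n)

Prefix : List Letter → Set
Prefix u = ∀ {i} → i < length u → nth i u ≡ t i

-- Of `word i` and `word k`, one is a prefix of the other, and both reach position `i`.
Prefix-word : ∀ k → Prefix (word k)
Prefix-word k {i} i< with ≤-total i k
... | inj₁ i≤k with word-prefix (k ∸ i) i
...   | v , eq rewrite m∸n+n≡m i≤k | eq = nth-++ (word i) (<length-word i)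
Prefix-word k {i} i< | inj₂ k≤i with word-prefix (i ∸ k) k
...   | v , eq rewrite m∸n+n≡m k≤i | eq = sym (nth-++ (word k) i<)

Prefix-++ : ∀ u v → Prefix (u ++ v) → Prefix u
Prefix-++ u v p i< = trans (sym (nth-++ u i<)) (p (≤-trans i< (length-++-≤ˡ u)))

Prefix-letter : ∀ u {l v} → Prefix (u ++ l ∷ v) → t (length u) ≡ l
Prefix-letter u {l} {v} p = trans (sym (p len<)) (nth-length u)
  where
  len< : length u < length (u ++ l ∷ v)
  len< = subst (length u <_) (sym (length-++ u)) (m<m+n _ (s≤s z≤n))

take≡applyUpTo : ∀ f n u → n ≤ length u → (∀ {i} → i < n → nth i u ≡ f i) →
  take n u ≡ applyUpTo f n
take≡applyUpTo f zero    u       _       _  = refl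
take≡applyUpTo f (suc n) (l ∷ u) (s≤s p) eq =
  cong₂ _∷_ (eq (s≤s z≤n)) (take≡applyUpTo (f ∘ suc) n u p (eq ∘ s≤s))

take-Prefix : ∀ {n u} → Prefix u → n ≤ length u → take n u ≡ P n
take-Prefix {n} {u} p n≤ = take≡applyUpTo t n u n≤ (λ i< → p (<-≤-trans i< n≤))

Prefix⇒P : ∀ {u} → Prefix u → P (length u) ≡ u
Prefix⇒P {u} p = trans (sym (take-Prefix p ≤-refl)) (take-all _ u ≤-refl)

-- This is the fixed-point property of `t`: `P n` begins `word n`, so its image begins
-- `word (suc n)`.
Prefix-τ*P : ∀ n → Prefix (τ* (P n))
Prefix-τ*P n = Prefix-++ (τ* (P n)) rest (subst Prefix eq (Prefix-word (suc n)))
  where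
  open ≡-Reasoning
  rest = τ* (drop n (word n))
  eq : word (suc n) ≡ τ* (P n) ++ rest
  eq = begin
    τ* (word n)                             ≡⟨ cong τ* (take++drop≡id n (word n)) ⟨
    τ* (take n (word n) ++ drop n (word n)) ≡⟨ τ*-++ (take n (word n)) _ ⟩
    τ* (take n (word n)) ++ rest            ≡⟨ cong (λ u → τ* u ++ rest)
                                                 (take-Prefix (Prefix-word n) (<⇒≤ (<length-word n))) ⟩
    τ* (P n) ++ rest                        ∎

-- Positions of the letters a and b: with indices from 0, A n and B n are the
-- positions of the n-th a and the n-th b in t.

A : ℕ → ℕ
A n = length (τ* (P n))

P-A : ∀ n → P (A n) ≡ τ* (P n)
P-A n = Prefix⇒P (Prefix-τ*P n)

τ*P-suc : ∀ n → τ* (P (suc n)) ≡ τ* (P n) ++ τ (t n)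
τ*P-suc n = trans (cong τ* (P-suc n))
  (trans (τ*-++ (P n) [ t n ]) (cong (τ* (P n) ++_) (++-identityʳ (τ (t n)))))

A-suc : ∀ n → A (suc n) ≡ A n + length (τ (t n))
A-suc n = trans (cong length (τ*P-suc n)) (length-++ (τ* (P n)))

Prefix-block : ∀ n → Prefix (τ* (P n) ++ τ (t n))
Prefix-block n = subst Prefix (τ*P-suc n) (Prefix-τ*P (suc n))

t-A : ∀ n → t (A n) ≡ a
t-A n with t n | Prefix-block n
... | a | p = Prefix-letter (τ* (P n)) p
... | b | p = Prefix-letter (τ* (P n)) p
... | c | p = Prefix-letter (τ* (P n)) p

t-sucA : ∀ n {l} → τ (t n) ≡ a ∷ l ∷ [] → t (suc (A n)) ≡ l
t-sucA n {l} eq = trans (cong t len) (Prefix-letter (τ* (P n) ++ [ a ]) p)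
  where
  len : suc (A n) ≡ length (τ* (P n) ++ [ a ])
  len = sym (trans (length-++ (τ* (P n))) (+-comm (A n) 1))
  p : Prefix ((τ* (P n) ++ [ a ]) ++ [ l ])
  p = subst Prefix (trans (cong (τ* (P n) ++_) eq) (sym (++-assoc (τ* (P n)) [ a ] [ l ])))
        (Prefix-block n)

-- Cutting the fixed point t of τ into the images τ (t n), every position falls
-- on the first or the second letter of such an image.
data Position : ℕ → Set where
  first  : ∀ n → Position (A n)
  second : ∀ n {l} → τ (t n) ≡ a ∷ l ∷ [] → Position (suc (A n))

position : ∀ i → Position i
position zero    = first 0
position (suc i) with position i
... | first n with t n in tn
...   | a = second n (cong τ tn)
...   | b = second n (cong τ tn)
...   | c = subst Position
              (trans (A-suc n) (trans (cong (λ l → A n + length (τ l)) tn) (+-comm (A n) 1)))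
              (first (suc n))
position (suc _) | second n eq =
  subst Position (trans (A-suc n) (trans (cong (λ u → A n + length u) eq) (+-comm (A n) 2)))
    (first (suc n))

τ≢aa : ∀ l → τ l ≢ a ∷ a ∷ []
τ≢aa a ()
τ≢aa b ()
τ≢aa c ()

τ≡ab⇒≡a : ∀ l → τ l ≡ a ∷ b ∷ [] → l ≡ a
τ≡ab⇒≡a a _ = refl

-- No image under `τ` has `a` as its second letter.
t≡a⇒A : ∀ i → t i ≡ a → ∃ λ n → i ≡ A n
t≡a⇒A i ti with position i
... | first n         = n , refl
... | second n {l} eq =
  contradiction (trans eq (cong (λ l → a ∷ l ∷ []) (trans (sym (t-sucA n eq)) ti))) (τ≢aa (t n))

-- A `b` occurs only as the second letter of `τ a`, and the image of the `a` at `A n` starts at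
-- `A (A n)`.
B : ℕ → ℕ
B n = suc (A (A n))

t≡b⇒B : ∀ i → t i ≡ b → ∃ λ n → i ≡ B n
t≡b⇒B i ti with position i
... | first n with () ← trans (sym ti) (t-A n)
... | second n eq =
  let tn     = τ≡ab⇒≡a (t n) (trans eq (cong (λ l → a ∷ l ∷ []) (trans (sym (t-sucA n eq)) ti)))
      m , n≡ = t≡a⇒A n tn
  in m , cong (suc ∘ A) n≡

t-B : ∀ n → t (B n) ≡ b
t-B n = t-sucA (A n) (cong τ (t-A n))

P-B : ∀ n → P (B n) ≡ τ* (τ* (P n)) ++ [ a ]
P-B n = trans (P-suc (A (A n)))
  (cong₂ (λ u l → u ++ [ l ]) (trans (P-A (A n)) (cong τ* (P-A n))) (t-A (A n)))

-- Weights of words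

wt : (Letter → ℕ) → List Letter → ℕ
wt f u = sum (map f u)

wt-++ : ∀ f u v → wt f (u ++ v) ≡ wt f u + wt f v
wt-++ f u v = trans (cong sum (map-++ f u v)) (sum-++ (map f u) (map f v))

wt-+ : ∀ f g u → wt (λ l → f l + g l) u ≡ wt f u + wt g u
wt-+ f g []      = refl
wt-+ f g (l ∷ u) = trans (cong ((f l + g l) +_) (wt-+ f g u))
  (solve 4 (λ p q r s → p :+ q :+ (r :+ s) := p :+ r :+ (q :+ s)) refl (f l) (g l) _ _)
  where open +-*-Solver

wt-τ* : ∀ {f g} → (∀ l → wt f (τ l) ≡ g l) → ∀ u → wt f (τ* u) ≡ wt g u
wt-τ* eq []      = refl
wt-τ* {f} eq (l ∷ u) = trans (wt-++ f (τ l) _) (cong₂ _+_ (eq l) (wt-τ* eq u))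

wt-P-suc : ∀ f n → wt f (P (suc n)) ≡ wt f (P n) + f (t n)
wt-P-suc f n = trans (cong (wt f) (P-suc n))
  (trans (wt-++ f (P n) [ t n ]) (cong (wt f (P n) +_) (+-identityʳ _)))

wx wd wy ws : Letter → ℕ
wx a = 2
wx b = 1
wx c = 1
wd a = 1
wd b = 2
wd c = 1
wy l = wx l + wd l
ws l = wx l + wy l

-- `wy l` is `length (τ l)` plus one, which ties the values of `y` to the positions `A`.
wt-wy : ∀ u → wt wy u ≡ length (τ* u) + length u
wt-wy []      = refl
wt-wy (a ∷ u) = trans (cong (3 +_) (wt-wy u)) (cong (2 +_) (sym (+-suc _ _)))
wt-wy (b ∷ u) = trans (cong (3 +_) (wt-wy u)) (cong (2 +_) (sym (+-suc _ _)))
wt-wy (c ∷ u) = trans (cong (2 +_) (wt-wy u)) (cong (1 +_) (sym (+-suc _ _)))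

-- x n and y n are the closed forms of X (n + 1) and Y (n + 1), and d n and s n
-- are their difference and sum.
x y d s : ℕ → ℕ
x n = 1 + wt wx (P n)
y n = 2 + wt wy (P n)
d n = 1 + wt wd (P n)
s n = 3 + wt ws (P n)

y≡x+d : ∀ n → y n ≡ x n + d n
y≡x+d n = cong suc (trans (cong suc (wt-+ wx wd (P n))) (sym (+-suc _ _)))

s≡x+y : ∀ n → s n ≡ x n + y n
s≡x+y n = cong suc (trans (cong (2 +_) (wt-+ wx wy (P n)))
  (sym (trans (+-suc _ _) (cong suc (+-suc _ _)))))

x-suc : ∀ n → x (suc n) ≡ x n + wx (t n)
x-suc n = cong suc (wt-P-suc wx n)

d-suc : ∀ n → d (suc n) ≡ d n + wd (t n)
d-suc n = cong suc (wt-P-suc wd n)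

y-suc : ∀ n → y (suc n) ≡ y n + wy (t n)
y-suc n = cong (2 +_) (wt-P-suc wy n)

s-suc : ∀ n → s (suc n) ≡ s n + ws (t n)
s-suc n = cong (3 +_) (wt-P-suc ws n)

0<wx : ∀ l → 0 < wx l
0<wx a = s≤s z≤n
0<wx b = s≤s z≤n
0<wx c = s≤s z≤n

-- Complementary sequences

module StrictMono {f : ℕ → ℕ} (step : ∀ n → f n < f (suc n)) where

  mono : ∀ {m n} → m < n → f m < f n
  mono {m} {suc n} (s≤s m≤n) with m≤n⇒m<n∨m≡n m≤n
  ... | inj₁ m<n  = <-trans (mono m<n) (step n)
  ... | inj₂ refl = step n

  mono-≤ : ∀ {m n} → m ≤ n → f m ≤ f n
  mono-≤ m≤n with m≤n⇒m<n∨m≡n m≤n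
  ... | inj₁ m<n  = <⇒≤ (mono m<n)
  ... | inj₂ refl = ≤-refl

  cancel-< : ∀ {m n} → f m < f n → m < n
  cancel-< {m} {n} fm<fn = ≰⇒> (λ n≤m → <⇒≱ fm<fn (mono-≤ n≤m))

-- f enumerates the positive integers but skips the value g n between the
-- indices q n and q n + 1.
record Skips (f g q : ℕ → ℕ) : Set where
  field
    start     : f 0 ≡ 1
    before    : ∀ n → suc (f (q n)) ≡ g n
    after     : ∀ n → f (suc (q n)) ≡ suc (g n)
    otherwise : ∀ i → (∃ λ n → i ≡ q n) ⊎ (f (suc i) ≡ suc (f i))
    g-step    : ∀ n → g n < g (suc n)

  f-step : ∀ i → f i < f (suc i)
  f-step i with otherwise i
  ... | inj₂ eq         = ≤-reflexive (sym eq)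
  ... | inj₁ (n , refl) = ≤-trans (≤-reflexive (before n))
                            (≤-trans (n≤1+n (g n)) (≤-reflexive (sym (after n))))

  module F = StrictMono f-step
  module G = StrictMono g-step

  -- Equality would force `q n < i`, but from `suc (q n)` on `f` is already above `g n`.
  disjoint : ∀ i n → f i ≢ g n
  disjoint i n eq = <⇒≱ {g n} ≤-refl (begin
    suc (g n)       ≡⟨ after n ⟨
    f (suc (q n))   ≤⟨ F.mono-≤ (F.cancel-< (≤-reflexive (trans (before n) (sym eq)))) ⟩
    f i             ≡⟨ eq ⟩
    g n             ∎)
    where open ≤-Reasoning

  cover : ∀ v → (∃ λ i → f i ≡ suc v) ⊎ (∃ λ n → g n ≡ suc v)
  cover zero = inj₁ (0 , start)
  cover (suc v) with cover v
  ... | inj₂ (n , eq) = inj₁ (suc (q n) , trans (after n) (cong suc eq))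
  ... | inj₁ (i , eq) with otherwise i
  ...   | inj₁ (n , refl) = inj₂ (n , trans (sym (before n)) (cong suc eq))
  ...   | inj₂ eq′        = inj₁ (suc i , trans eq′ (cong suc eq))

  between : ∀ k i → g k + suc i < g (suc k) → f (q k + suc i) ≡ g k + suc i
  between k zero    _  = trans (cong f (+-comm (q k) 1)) (trans (after k) (+-comm 1 (g k)))
  between k (suc i) lt with between k i (<-trans (+-monoʳ-< (g k) ≤-refl) lt) | otherwise (q k + suc i)
  ... | ih | inj₂ eq = trans (cong f (+-suc (q k) (suc i)))
                         (trans eq (trans (cong suc ih) (sym (+-suc (g k) (suc i)))))
  -- Another skip inside the stretch would put `g m` strictly between `g k` and `g (suc k)`.
  ... | ih | inj₁ (m , eq) =
    contradiction (G.cancel-< (subst (_< g (suc k)) (sym gm) lt))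
      (≤⇒≯ (G.cancel-< (subst (g k <_) (sym gm) (m<m+n (g k) (s≤s z≤n)))))
    where
    gm : g m ≡ g k + suc (suc i)
    gm = trans (sym (before m)) (trans (cong (suc ∘ f) (sym eq))
           (trans (cong suc ih) (sym (+-suc (g k) (suc i)))))

-- Complementarity of `x` with `y` and of `d` with `s`.

y-step : ∀ n → y n < y (suc n)
y-step n = subst (y n <_) (sym (y-suc n)) (m<m+n (y n) (≤-trans (0<wx (t n)) (m≤m+n _ _)))

s-step : ∀ n → s n < s (suc n)
s-step n = subst (s n <_) (sym (s-suc n)) (m<m+n (s n) (≤-trans (0<wx (t n)) (m≤m+n _ _)))

xy : Skips x y A
xy = record
  { start     = refl
  ; before    = before
  ; after     = λ n → trans (x-suc (A n)) (trans (cong (λ l → x (A n) + wx l) (t-A n))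
                        (trans (+-comm (x (A n)) 2) (cong suc (before n))))
  ; otherwise = otherwise
  ; g-step    = y-step
  }
  where
  before : ∀ n → suc (x (A n)) ≡ y n
  -- The total of `wx` over `τ l` is `wy l`; the offsets 1 in `x` and 2 in `y` account for the
  -- `suc`.
  before n = cong (2 +_) (trans (cong (wt wx) (P-A n))
    (wt-τ* (λ { a → refl ; b → refl ; c → refl }) (P n)))

  otherwise : ∀ i → (∃ λ n → i ≡ A n) ⊎ (x (suc i) ≡ suc (x i))
  otherwise i with t i in ti | x-suc i
  ... | a | _  = inj₁ (t≡a⇒A i ti)
  ... | b | eq = inj₂ (trans eq (+-comm (x i) 1))
  ... | c | eq = inj₂ (trans eq (+-comm (x i) 1))

ds : Skips d s B
ds = record
  { start     = refl
  ; before    = before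
  ; after     = λ n → trans (d-suc (B n)) (trans (cong (λ l → d (B n) + wd l) (t-B n))
                        (trans (+-comm (d (B n)) 2) (cong suc (before n))))
  ; otherwise = otherwise
  ; g-step    = s-step
  }
  where
  wd-τ : Letter → ℕ
  wd-τ l = wt wd (τ l)

  before : ∀ n → suc (d (B n)) ≡ s n
  -- Two passes of `τ` turn `wd` into weights 3, 2, 1 and then 5, 4, 3, which is `ws`; the `a` just
  -- before the `b` adds 1.
  before n = cong (2 +_) (begin
    wt wd (P (B n))                       ≡⟨ cong (wt wd) (P-B n) ⟩
    wt wd (τ* (τ* (P n)) ++ [ a ])        ≡⟨ wt-++ wd (τ* (τ* (P n))) [ a ] ⟩
    wt wd (τ* (τ* (P n))) + 1             ≡⟨ cong (_+ 1) (wt-τ* {g = wd-τ} (λ _ → refl) (τ* (P n))) ⟩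
    wt wd-τ (τ* (P n)) + 1                ≡⟨ cong (_+ 1) (wt-τ* (λ { a → refl ; b → refl ; c → refl }) (P n)) ⟩
    wt ws (P n) + 1                       ≡⟨ +-comm _ 1 ⟩
    1 + wt ws (P n)                       ∎)
    where open ≡-Reasoning

  otherwise : ∀ i → (∃ λ n → i ≡ B n) ⊎ (d (suc i) ≡ suc (d i))
  otherwise i with t i in ti | d-suc i
  ... | b | _  = inj₁ (t≡b⇒B i ti)
  ... | a | eq = inj₂ (trans eq (+-comm (d i) 1))
  ... | c | eq = inj₂ (trans eq (+-comm (d i) 1))

module XY = Skips xy
module DS = Skips ds

y∸x : ∀ n → y n ∸ x n ≡ d n
y∸x n = trans (cong (_∸ x n) (y≡x+d n)) (m+n∸m≡n (x n) (d n))

y+x : ∀ n → y n + x n ≡ s n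
y+x n = trans (+-comm (y n) (x n)) (sym (s≡x+y n))

x<y : ∀ n → x n < y n
x<y n = subst (x n <_) (sym (y≡x+d n)) (m<m+n (x n) (s≤s z≤n))

d<s : ∀ n → d n < s n
d<s n = subst (d n <_) (trans (cong (_+ x n) (sym (trans (y≡x+d n) (+-comm (x n) (d n)))))
  (y+x n)) (≤-trans (m<m+n (d n) {x n} (s≤s z≤n)) (m≤m+n _ (x n)))

-- The greedy choice

module _ {X Y : ℕ → ℕ} (greedy : IsGreedyPair X Y) where
  open IsGreedyPair greedy

  Closed : ℕ → Set
  Closed n = X (suc n) ≡ x n × Y (suc n) ≡ y n

  module _ {n} (ih : ∀ {k} → k < n → Closed k) where

    earlier : ∀ {u v} → Good X Y (suc n) u v → ∀ k → k < n → Avoids (x k) (y k) u v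
    earlier {u} {v} g k k<n = let p , q = ih k<n in
      subst₂ (λ α β → Avoids α β u v) p q (Good.fresh g (suc k) (s≤s z≤n) (s≤s k<n))

    -- The six conditions reduce to monotonicity of `x`, `y`, `d` and disjointness of `x` from `y`
    -- and of `d` from `s`.
    closed-good : Good X Y (suc n) (x n) (y n)
    closed-good = good (s≤s z≤n) (x<y n) fresh
      where
      fresh : ∀ k → 1 ≤ k → k < suc n → Avoids (X k) (Y k) (x n) (y n)
      fresh (suc k) _ (s≤s k<n) = let p , q = ih k<n in
        subst₂ (λ α β → Avoids α β (x n) (y n)) (sym p) (sym q)
          ( >⇒≢ (XY.F.mono k<n)
          , XY.disjoint n k
          , (XY.disjoint k n ∘ sym)
          , >⇒≢ (XY.G.mono k<n)
          , subst₂ _≢_ (sym (y∸x n)) (sym (y∸x k)) (>⇒≢ (DS.F.mono k<n))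
          , subst₂ _≢_ (sym (y∸x n)) (sym (y+x k)) (DS.disjoint n k) )

    -- By `cover`, a smaller positive `u` is some `x k` or `y k`; monotonicity gives `k < n`, so it
    -- is already taken.
    x-minimal : ∀ {u v} → Good X Y (suc n) u v → x n ≤ u
    x-minimal {zero}  g with () ← Good.positive g
    x-minimal {suc u} g = ≮⇒≥ λ u<x → absurd u<x (XY.cover u)
      where
      absurd : suc u < x n → ¬ ((∃ λ i → x i ≡ suc u) ⊎ (∃ λ i → y i ≡ suc u))
      absurd u<x (inj₁ (k , eq)) =
        proj₁ (earlier g k (XY.F.cancel-< (subst (_< x n) (sym eq) u<x))) (sym eq)
      absurd u<x (inj₂ (k , eq)) =
        proj₁ (proj₂ (earlier g k (XY.G.cancel-< (subst (_< y n) (sym eq) (<-trans u<x (x<y n)))))) (sym eq)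

    -- With the first entry fixed, a smaller `v` gives a difference below `d n`, hence some `d k` or
    -- `s k` with `k < n`.
    y-minimal : ∀ {v} → Good X Y (suc n) (x n) v → y n ≤ v
    y-minimal {v} g = ≮⇒≥ λ v<y →
      let e , eq = ∸-positive (Good.ordered g) in absurd e eq v<y (DS.cover e)
      where
      ∸-positive : ∀ {m n} → m < n → ∃ λ e → n ∸ m ≡ suc e
      ∸-positive {m} {n} lt with n ∸ m | m<n⇒0<n∸m lt
      ... | suc e | _ = e , refl
      v∸x<d : v < y n → v ∸ x n < d n
      v∸x<d v<y = subst (v ∸ x n <_) (y∸x n) (∸-monoˡ-< v<y (<⇒≤ (Good.ordered g)))
      absurd : ∀ e → v ∸ x n ≡ suc e → v < y n → ¬ ((∃ λ i → d i ≡ suc e) ⊎ (∃ λ i → s i ≡ suc e))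
      absurd e eq v<y (inj₁ (k , dk)) =
        let k<n = DS.F.cancel-< (subst (_< d n) (trans eq (sym dk)) (v∸x<d v<y))
            _ , _ , _ , _ , ≢d , _ = earlier g k k<n
        in ≢d (trans eq (trans (sym dk) (sym (y∸x k))))
      absurd e eq v<y (inj₂ (k , sk)) =
        let k<n = DS.G.cancel-< (<-trans (subst (_< d n) (trans eq (sym sk)) (v∸x<d v<y)) (d<s n))
            _ , _ , _ , _ , _ , ≢s = earlier g k k<n
        in ≢s (trans eq (trans (sym sk) (sym (y+x k))))

  closed : ∀ n → Closed n
  closed = <-rec Closed go
    where
    go : ∀ n → (∀ {k} → k < n → Closed k) → Closed n
    go zero    _  = X1 , Y1
    go (suc n) ih = X≡ , ≤-antisym Y≤ (y-minimal ih g)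
      where
      X≡ : X (suc (suc n)) ≡ x (suc n)
      X≡ with X-least (suc (suc n)) (s≤s (s≤s z≤n))
      ... | (_ , g) , least = ≤-antisym (least _ (_ , closed-good ih)) (x-minimal ih g)
      g : Good X Y (suc (suc n)) (x (suc n)) (Y (suc (suc n)))
      g = subst (λ u → Good X Y (suc (suc n)) u (Y (suc (suc n)))) X≡
            (proj₁ (Y-least (suc (suc n)) (s≤s (s≤s z≤n))))
      Y≤ : Y (suc (suc n)) ≤ y (suc n)
      Y≤ = proj₂ (Y-least (suc (suc n)) (s≤s (s≤s z≤n))) _
             (subst (λ u → Good X Y (suc (suc n)) u (y (suc n))) (sym X≡) (closed-good ih))

-- Balanced blocks

-- A balanced pair can be stripped from the front: it shifts `k` in `Close` by `length v`, and `e`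
-- and the lengths compared with it by `length (τ* v)`.
record Balanced (u v : List Letter) : Set where
  constructor balanced
  field
    wx≡ : wt wx u ≡ length v
    wy≡ : wt wy u ≡ length (τ* v)

-- For prefixes u and v of t, adding 2 + k to the two inequalities gives
-- y k ≤ x n + y n < y (k + 1), where k = x n - 1.
Close : List Letter → List Letter → ℕ → Set
Close u v n =
  k < length v × length (τ* (take k v)) ≤ suc e × suc e ≤ length (τ* (take (suc k) v))
  where
  k = wt wx (take n u)
  e = wt wy (take n u)

close? : ∀ u v n → Dec (Close u v n)
close? u v n = (_ <? _) ×-dec (_ ≤? _) ×-dec (_ ≤? _)

close-++ˡ : ∀ {u v n} u′ v′ → n < length u → Close u v n → Close (u ++ u′) (v ++ v′) n
close-++ˡ {u} {v} {n} u′ v′ n< (k< , lo , hi)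
  rewrite take-++ˡ u {u′} (<⇒≤ n<) | take-++ˡ v {v′} (<⇒≤ k<) | take-++ˡ v {v′} k<
  = <-≤-trans k< (length-++-≤ˡ v) , lo , hi

close-++ʳ : ∀ {u v u′ v′ n} → Balanced u v → Close u′ v′ n → Close (u ++ u′) (v ++ v′) (length u + n)
close-++ʳ {u} {v} {u′} {v′} {n} (balanced wx≡ wy≡) (k< , lo , hi)
  rewrite take-++ʳ n u {u′} | wt-++ wx u (take n u′) | wt-++ wy u (take n u′) | wx≡ | wy≡
        | sym (+-suc (length v) (wt wx (take n u′)))
        | sym (+-suc (length (τ* v)) (wt wy (take n u′)))
        | take-++ʳ (wt wx (take n u′)) v {v′} | take-++ʳ (suc (wt wx (take n u′))) v {v′}
        | τ*-++ v (take (wt wx (take n u′)) v′) | τ*-++ v (take (suc (wt wx (take n u′))) v′)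
        | length-++ (τ* v) {τ* (take (wt wx (take n u′)) v′)}
        | length-++ (τ* v) {τ* (take (suc (wt wx (take n u′))) v′)}
        | length-++ v {v′}
  = +-monoʳ-≤ (length v) k<
  , +-monoʳ-≤ (length (τ* v)) lo
  , +-monoʳ-≤ (length (τ* v)) hi

-- The pair of (ab, aba) and what it generates: applying τ to both components of
-- a pair (upper β, lower β) and cutting wherever the letter counts of the lower
-- side are those of the upper side times M² - M, for M the incidence matrix of τ,
-- yields the pairs listed in θ β.  (M² - M maps weights 1, 1, 1 to 2, 1, 1.)
data Block : Set where
  β₀ β₁ β₂ β₃ β₄ β₅ β₆ β₇ β₈ : Block

upper lower : Block → List Letter
upper β₀ = a ∷ b ∷ []
upper β₁ = a ∷ []
upper β₂ = c ∷ []
upper β₃ = a ∷ b ∷ []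
upper β₄ = a ∷ []
upper β₅ = a ∷ c ∷ []
upper β₆ = b ∷ a ∷ []
upper β₇ = a ∷ c ∷ a ∷ b ∷ []
upper β₈ = a ∷ b ∷ []
lower β₀ = a ∷ b ∷ a ∷ []
lower β₁ = c ∷ a ∷ []
lower β₂ = b ∷ []
lower β₃ = a ∷ a ∷ b ∷ []
lower β₄ = a ∷ c ∷ []
lower β₅ = b ∷ a ∷ c ∷ []
lower β₆ = a ∷ b ∷ a ∷ []
lower β₇ = a ∷ b ∷ a ∷ c ∷ a ∷ b ∷ []
lower β₈ = b ∷ a ∷ a ∷ []

θ : Block → List Block
θ β₀ = β₀ ∷ β₁ ∷ β₂ ∷ []
θ β₁ = β₃ ∷ []
θ β₂ = β₄ ∷ []
θ β₃ = β₀ ∷ β₅ ∷ []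
θ β₄ = β₀ ∷ []
θ β₅ = β₄ ∷ β₆ ∷ []
θ β₆ = β₇ ∷ []
θ β₇ = β₀ ∷ β₁ ∷ β₈ ∷ β₅ ∷ []
θ β₈ = β₄ ∷ β₆ ∷ β₂ ∷ []

upper* lower* : List Block → List Letter
upper* = concatMap upper
lower* = concatMap lower

block-balanced : ∀ β → Balanced (upper β) (lower β)
block-balanced β₀ = balanced refl refl
block-balanced β₁ = balanced refl refl
block-balanced β₂ = balanced refl refl
block-balanced β₃ = balanced refl refl
block-balanced β₄ = balanced refl refl
block-balanced β₅ = balanced refl refl
block-balanced β₆ = balanced refl refl
block-balanced β₇ = balanced refl refl
block-balanced β₈ = balanced refl refl

block-close? : ∀ β → Dec (∀ {n} → n < length (upper β) → Close (upper β) (lower β) n)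
block-close? β = allUpTo? (close? (upper β) (lower β)) (length (upper β))

block-close : ∀ β {n} → n < length (upper β) → Close (upper β) (lower β) n
block-close β₀ = from-yes (block-close? β₀)
block-close β₁ = from-yes (block-close? β₁)
block-close β₂ = from-yes (block-close? β₂)
block-close β₃ = from-yes (block-close? β₃)
block-close β₄ = from-yes (block-close? β₄)
block-close β₅ = from-yes (block-close? β₅)
block-close β₆ = from-yes (block-close? β₆)
block-close β₇ = from-yes (block-close? β₇)
block-close β₈ = from-yes (block-close? β₈)

upper-θ : ∀ β → upper* (θ β) ≡ τ* (upper β)
upper-θ β₀ = refl
upper-θ β₁ = refl
upper-θ β₂ = refl
upper-θ β₃ = refl
upper-θ β₄ = refl
upper-θ β₅ = refl
upper-θ β₆ = refl
upper-θ β₇ = refl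
upper-θ β₈ = refl

lower-θ : ∀ β → lower* (θ β) ≡ τ* (lower β)
lower-θ β₀ = refl
lower-θ β₁ = refl
lower-θ β₂ = refl
lower-θ β₃ = refl
lower-θ β₄ = refl
lower-θ β₅ = refl
lower-θ β₆ = refl
lower-θ β₇ = refl
lower-θ β₈ = refl

-- Whole blocks are stripped until position `n` falls inside a single one, where the finite check
-- applies.
blocks-close : ∀ βs {n} → n < length (upper* βs) → Close (upper* βs) (lower* βs) n
blocks-close (β ∷ βs) {n} n< with n <? length (upper β)
... | yes n<β = close-++ˡ (upper* βs) (lower* βs) n<β (block-close β n<β)
... | no  n≮β = subst (Close (upper* (β ∷ βs)) (lower* (β ∷ βs))) eq
      (close-++ʳ {upper β} {lower β} (block-balanced β) (blocks-close βs m<))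
  where
  m = n ∸ length (upper β)
  eq : length (upper β) + m ≡ n
  eq = m+[n∸m]≡n (≮⇒≥ n≮β)
  m< : m < length (upper* βs)
  m< = +-cancelˡ-< (length (upper β)) _ _
         (subst₂ _<_ (sym eq) (length-++ (upper β)) n<)

blockWord : ℕ → List Block
blockWord zero    = [ β₀ ]
blockWord (suc k) = concatMap θ (blockWord k)

-- With `f` either `upper` or `lower`, iterating `θ` from `β₀` decomposes two prefixes of `t` in
-- parallel.
concatMap-θ : ∀ {f : Block → List Letter} → (∀ β → concatMap f (θ β) ≡ τ* (f β)) →
  ∀ βs → concatMap f (concatMap θ βs) ≡ τ* (concatMap f βs)
concatMap-θ {f} eq βs = trans (concatMap-concatMap f θ βs)
  (trans (concatMap-cong eq βs) (sym (concatMap-concatMap τ f βs)))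

upper-blockWord : ∀ k → upper* (blockWord k) ≡ word (suc k)
upper-blockWord zero    = refl
upper-blockWord (suc k) = trans (concatMap-θ upper-θ (blockWord k)) (cong τ* (upper-blockWord k))

lower-blockWord : ∀ k → ∃ λ v → word (2 + k) ≡ lower* (blockWord k) ++ v
-- `word 2` is `abac`, of which `lower β₀` covers `aba`.
lower-blockWord zero    = [ c ] , refl
lower-blockWord (suc k) =
  let v , eq = lower-blockWord k
  in τ* v , trans (cong τ* eq) (trans (τ*-++ (lower* (blockWord k)) v)
       (cong (_++ τ* v) (sym (concatMap-θ lower-θ (blockWord k)))))

-- Transfer of the block inequality to the tribonacci word.

A-bounds : ℕ → Set
A-bounds n = A k ≤ suc e × suc e ≤ A (suc k)
  where
  k = wt wx (P n)
  e = wt wy (P n)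

close⇒A-bounds : ∀ {u v n} → Prefix u → Prefix v → n < length u → Close u v n → A-bounds n
close⇒A-bounds {u} {v} pu pv n< (k< , lo , hi)
  rewrite take-Prefix {u = u} pu (<⇒≤ n<) | take-Prefix {u = v} pv (<⇒≤ k<) | take-Prefix {u = v} pv k<
  = lo , hi

A-bounded : ∀ n → A-bounds n
A-bounded n = close⇒A-bounds {upper* βs} {lower* βs} upper-prefix lower-prefix n< (blocks-close βs n<)
  where
  βs = blockWord n
  n< : n < length (upper* βs)
  n< = subst (λ u → n < length u) (sym (upper-blockWord n)) (<-trans ≤-refl (<length-word (suc n)))
  upper-prefix : Prefix (upper* βs)
  upper-prefix = subst Prefix (sym (upper-blockWord n)) (Prefix-word (suc n))
  lower-prefix : Prefix (lower* βs)
  lower-prefix = let v , eq = lower-blockWord n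
                 in Prefix-++ (lower* βs) v (subst Prefix eq (Prefix-word (2 + n)))

-- The sum of a pair

y-A : ∀ n → y n ≡ 2 + (A n + n)
y-A n = cong (2 +_) (trans (wt-wy (P n)) (cong (A n +_) (length-applyUpTo t n)))

wy≤3 : ∀ l → wy l ≤ 3
wy≤3 a = ≤-refl
wy≤3 b = ≤-refl
wy≤3 c = n≤1+n 2

-- The offset `i` is below 3 because `y` grows by at most 3 per step. The last component locates the
-- index `y n` just after the skip of `y k` by `x`.
sum-in-gap : ∀ n → let k = wt wx (P n) in
  ∃ λ i → i < 3 × x n + y n ≡ y k + i × y k + i < y (suc k) × y n ≡ suc (A k + i)
sum-in-gap n = i , +-cancelˡ-< (y k) i 3 (<-≤-trans lt ≤y+3) , total , lt , yn
  where
  open ≤-Reasoning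
  k = wt wx (P n)
  i = suc (wt wy (P n)) ∸ A k
  Ai : A k + i ≡ suc (wt wy (P n))
  Ai = m+[n∸m]≡n (proj₁ (A-bounded n))
  yn : y n ≡ suc (A k + i)
  yn = cong suc (sym Ai)
  total : x n + y n ≡ y k + i
  total = begin-equality
    suc k + y n              ≡⟨ cong (λ e → suc k + e) yn ⟩
    suc k + suc (A k + i)    ≡⟨ solve 3 (λ k A i →
                                   con 1 :+ k :+ (con 1 :+ (A :+ i)) := con 2 :+ (A :+ k) :+ i)
                                   refl k (A k) i ⟩
    2 + (A k + k) + i        ≡⟨ cong (λ e → e + i) (y-A k) ⟨
    y k + i                  ∎
    where open +-*-Solver
  lt : y k + i < y (suc k)
  lt = begin-strict
    y k + i                   ≡⟨ total ⟨
    suc k + y n               ≤⟨ +-monoʳ-≤ (suc k) (s≤s (proj₂ (A-bounded n))) ⟩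
    suc k + suc (A (suc k))   ≡⟨ +-comm (suc k) _ ⟩
    suc (A (suc k) + suc k)   <⟨ ≤-refl ⟩
    2 + (A (suc k) + suc k)   ≡⟨ y-A (suc k) ⟨
    y (suc k)                 ∎
  ≤y+3 : y (suc k) ≤ y k + 3
  ≤y+3 = ≤-trans (≤-reflexive (y-suc k)) (+-monoʳ-≤ (y k) (wy≤3 (t k)))

open import Data.Integer as ℤ using (+_)

mainTheorem2 : ∀ (X Y : ℕ → ℕ) → IsGreedyPair X Y →
    (∀ n → n ≥ 1 → (X (Y n) ≡ X n + Y n) ⊎ (Y (X n) ≡ X n + Y n))
    ×
    (∀ n → n ≥ 1 → + X n ℤ.+ + Y n ℤ.- + Y (X n) ∈ (+ 0 ∷ + 1 ∷ + 2 ∷ []))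
mainTheorem2 X Y greedy = part₁ , part₂
  where
  X≡ : ∀ n → X (suc n) ≡ x n
  X≡ n = proj₁ (closed greedy n)
  Y≡ : ∀ n → Y (suc n) ≡ y n
  Y≡ n = proj₂ (closed greedy n)
  YX : ∀ n → Y (X (suc n)) ≡ y (wt wx (P n))
  YX n = trans (cong Y (X≡ n)) (Y≡ (wt wx (P n)))

  part₁ : ∀ n → n ≥ 1 → (X (Y n) ≡ X n + Y n) ⊎ (Y (X n) ≡ X n + Y n)
  part₁ (suc n) _ with sum-in-gap n
  -- At offset 0 the sum is `y k` itself, which is `Y (X (suc n))`.
  ... | zero , _ , total , _ , _ = inj₂ (trans (YX n) (trans (sym (+-identityʳ _))
          (trans (sym total) (sym (cong₂ _+_ (X≡ n) (Y≡ n))))))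
  -- Otherwise the sum lies strictly between consecutive values of `y`, so it is a value of `x`, at
  -- index `A k + suc i`.
  ... | suc i , _ , total , lt , yn = inj₁ (begin
    X (Y (suc n))                    ≡⟨ cong X (trans (Y≡ n) yn) ⟩
    X (suc (A k + suc i))            ≡⟨ X≡ _ ⟩
    x (A k + suc i)                  ≡⟨ XY.between k i lt ⟩
    y k + suc i                      ≡⟨ total ⟨
    x n + y n                        ≡⟨ cong₂ _+_ (X≡ n) (Y≡ n) ⟨
    X (suc n) + Y (suc n)            ∎)
    where
    open ≡-Reasoning
    k = wt wx (P n)

  part₂ : ∀ n → n ≥ 1 → + X n ℤ.+ + Y n ℤ.- + Y (X n) ∈ (+ 0 ∷ + 1 ∷ + 2 ∷ [])
  part₂ (suc n) _ with sum-in-gap n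
  ... | i , i<3 , total , _ , _ = subst (_∈ _) (sym diff) (small i i<3)
    where
    open ≡-Reasoning
    k = wt wx (P n)
    small : ∀ i → i < 3 → + i ∈ (+ 0 ∷ + 1 ∷ + 2 ∷ [])
    small 0 _ = here refl
    small 1 _ = there (here refl)
    small 2 _ = there (there (here refl))
    small (suc (suc (suc _))) (s≤s (s≤s (s≤s ())))
    diff : + X (suc n) ℤ.+ + Y (suc n) ℤ.- + Y (X (suc n)) ≡ + i
    diff = begin
      + (X (suc n) + Y (suc n)) ℤ.- + Y (X (suc n))
        ≡⟨ cong₂ (λ p q → + p ℤ.- + q) (trans (cong₂ _+_ (X≡ n) (Y≡ n)) total) (YX n) ⟩
      + (y k + i) ℤ.- + y k   ≡⟨ m-n≡m⊖n (y k + i) (y k) ⟩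
      (y k + i) ℤ.⊖ y k       ≡⟨ ⊖-≥ (m≤m+n (y k) i) ⟩
      + (y k + i ∸ y k)       ≡⟨ cong +_ (m+n∸m≡n (y k) i) ⟩
      + i                     ∎
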